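{- The zero forcing number of the generalized Petersen graph $P(12,3)$ is $Z(P(12,3)) = 7$. In particular, the assertion "$Z(P(n,3)) = 8$ for all $n \ge 12$" is false at $n = 12$.
   Context: Let $G=(V,E)$ be a finite simple graph. Color a subset $S\subseteq V$ black and the remaining vertices white. Color change rule: a black vertex with exactly one white neighbor forces that neighbor to become black. Iterating this rule starting from $S$ until no further force is possible gives the closure $\mathrm{cl}(S)$. The set $S$ is a zero forcing set of $G$ if $\mathrm{cl}(S)=V$, and the zero forcing number $Z(G)$ is the minimum cardinality of a zero forcing set. For $n\ge 3$ and $1\le k<n/2$, the generalized Petersen graph $P(n,k)$ has the $2n$ vertices $\{u_0,\dots,u_{n-1}\}\cup\{v_0,\dots,v_{n-1}\}$ and edges $u_i\sim u_{i+1}$, $u_i\sim v_i$, and $v_i\sim v_{i+k}$ for all $i$, with indices taken modulo $n$. -}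

module Defs where

open import Data.Bool.Properties using () renaming (_≟_ to _≟ᵇ_)
open import Data.Empty using (⊥-elim)
open import Data.Fin.Base using (Fin; toℕ; _↑ˡ_; _↑ʳ_; splitAt)
open import Data.Fin.Properties
  using (_≟_; any?; all?; ↑ˡ-injective; ↑ʳ-injective; splitAt-↑ˡ; splitAt-↑ʳ;
         toℕ-fromℕ<)
open import Data.Fin.Subset
  using (Subset; _∈_; _∉_; _⊆_; _⊃_; _∪_; ⁅_⁆; ⊤; ∣_∣)
open import Data.Fin.Subset.Induction using (⊃-wellFounded)
open import Data.Fin.Subset.Properties
  using (_∈?_; anySubset?; ⊆-antisym; p⊆p∪q; q⊆p∪q; x∈p∪q⁻; x∈⁅x⁆; x∈⁅y⁆⇒x≡y; ∈⊤)
open import Data.Nat.Base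
  using (ℕ; _+_; _*_; _≤_; _<_; NonZero; >-nonZero; s≤s; z≤n; _%_; _/_)
open import Data.Nat.DivMod using (_mod_; m≡m%n+[m/n]*n)
open import Data.Nat.Divisibility using (divides; >⇒∤)
open import Data.Nat.Induction using (<-wellFounded)
open import Data.Nat.Properties
  using (_≤?_; _<?_; ≤-trans; ≤-<-trans; ≮⇒≥; m≤m+n; +-cancelˡ-≡)
open import Data.Product.Base using (∃-syntax; _×_; _,_; proj₁; proj₂)
open import Data.Sum.Base using (_⊎_; inj₁; inj₂)
open import Data.Vec.Properties using (≡-dec)
open import Function.Base using (_∘_)
open import Induction.WellFounded using (Acc; acc)
open import Relation.Binary.Construct.Closure.ReflexiveTransitive
  using (Star; ε; _◅_)
open import Relation.Binary.Construct.Closure.Symmetric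
  using (SymClosure; fwd; bwd; symmetric)
open import Relation.Binary.Core using (Rel)
open import Relation.Binary.Definitions using (Decidable; Irreflexive; Symmetric)
open import Relation.Binary.PropositionalEquality
  using (_≡_; _≢_; refl; sym; trans; cong; subst)
open import Relation.Nullary
  using (¬_; Dec; yes; no; ¬?; _×-dec_; _⊎-dec_; _→-dec_; map′; recompute)
open import Level using (0ℓ)

record Graph : Set₁ where
  field
    order  : ℕ
    Adj    : Rel (Fin order) 0ℓ
    adj?   : Decidable Adj
    symm   : Symmetric Adj
    irrefl : Irreflexive _≡_ Adj

module ZeroForcing (G : Graph) where
  open Graph G

  -- A colouring is represented by its set of black vertices.

  Forces : Subset order → Fin order → Fin order → Set
  Forces B u w =
    u ∈ B × (Adj u w × w ∉ B) × (∀ x → Adj u x → x ∉ B → x ≡ w)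

  data _⟶_ (B : Subset order) : Subset order → Set where
    force : ∀ {u w} → Forces B u w → B ⟶ (B ∪ ⁅ w ⁆)

  _⟶*_ : Rel (Subset order) 0ℓ
  _⟶*_ = Star _⟶_

  Stalled : Subset order → Set
  Stalled B = ∀ u w → ¬ Forces B u w

  IsClosure : Subset order → Subset order → Set
  IsClosure S T = S ⟶* T × Stalled T

  forces? : ∀ B u w → Dec (Forces B u w)
  forces? B u w =
    (u ∈? B) ×-dec (adj? u w ×-dec ¬? (w ∈? B)) ×-dec
    all? (λ x → adj? u x →-dec (¬? (x ∈? B) →-dec (x ≟ w)))

  private
    grows : ∀ {B u w} → Forces B u w → (B ∪ ⁅ w ⁆) ⊃ B
    grows {B} {w = w} (_ , (_ , w∉B) , _) =
      p⊆p∪q ⁅ w ⁆ , w , q⊆p∪q B ⁅ w ⁆ (x∈⁅x⁆ w) , w∉B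

    closure-acc : ∀ S → Acc _⊃_ S → ∃[ T ] IsClosure S T
    closure-acc S (acc rec) with any? (λ u → any? (forces? S u))
    ... | no stuck = S , ε , λ u w f → stuck (u , w , f)
    ... | yes (u , w , f) with closure-acc (S ∪ ⁅ w ⁆) (rec (grows f))
    ...   | T , steps , stalled = T , force f ◅ steps , stalled

    ⟶*-below : ∀ {S T U} → S ⟶* T → S ⊆ U → Stalled U → T ⊆ U
    ⟶*-below ε S⊆U _ = S⊆U
    ⟶*-below {S} {U = U} (force {u} {w} (u∈S , (uw , _) , only) ◅ steps) S⊆U stalled =
      ⟶*-below steps S∪w⊆U stalled
      where
      w∈U : w ∈ U
      w∈U with w ∈? U
      ... | yes p = p
      ... | no w∉U = ⊥-elim (stalled u w
              (S⊆U u∈S , (uw , w∉U) , λ x ux x∉U → only x ux (x∉U ∘ S⊆U)))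

      S∪w⊆U : (S ∪ ⁅ w ⁆) ⊆ U
      S∪w⊆U x∈ with x∈p∪q⁻ S ⁅ w ⁆ x∈
      ... | inj₁ x∈S = S⊆U x∈S
      ... | inj₂ x∈w = subst (_∈ U) (sym (x∈⁅y⁆⇒x≡y w x∈w)) w∈U

    ⟶*-⊆ : ∀ {S T} → S ⟶* T → S ⊆ T
    ⟶*-⊆ ε = λ x∈S → x∈S
    ⟶*-⊆ (force {w = w} _ ◅ steps) = ⟶*-⊆ steps ∘ p⊆p∪q ⁅ w ⁆

  -- The order in which forces are applied does not matter.
  closure-unique : ∀ {S T U} → IsClosure S T → IsClosure S U → T ≡ U
  closure-unique (S⟶T , T-stalled) (S⟶U , U-stalled) = ⊆-antisym
    (⟶*-below S⟶T (⟶*-⊆ S⟶U) U-stalled)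
    (⟶*-below S⟶U (⟶*-⊆ S⟶T) T-stalled)

  -- Opaque, so that the type checker never runs the search.
  opaque
    closure : ∀ S → ∃[ T ] IsClosure S T
    closure S = closure-acc S (⊃-wellFounded S)

  cl : Subset order → Subset order
  cl S = proj₁ (closure S)

  IsZeroForcing : Subset order → Set
  IsZeroForcing S = cl S ≡ ⊤

  isZeroForcing? : ∀ S → Dec (IsZeroForcing S)
  isZeroForcing? S = ≡-dec _≟ᵇ_ (cl S) ⊤

  IsMinimumZeroForcing : Subset order → Set
  IsMinimumZeroForcing S =
    IsZeroForcing S × (∀ T → IsZeroForcing T → ∣ S ∣ ≤ ∣ T ∣)

  private
    ⊤-zeroForcing : IsZeroForcing ⊤
    ⊤-zeroForcing = closure-unique (proj₂ (closure ⊤))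
      (ε , λ { u w (_ , (_ , w∉⊤) , _) → w∉⊤ ∈⊤ })

    minimum-acc : ∀ S → Acc _<_ ∣ S ∣ → IsZeroForcing S →
                  ∃[ T ] IsMinimumZeroForcing T
    minimum-acc S (acc rec) zf
      with anySubset? (λ T → isZeroForcing? T ×-dec (∣ T ∣ <? ∣ S ∣))
    ... | yes (T , zfT , T<S) = minimum-acc T (rec T<S) zfT
    ... | no none = S , zf , λ T zfT → ≮⇒≥ (λ T<S → none (T , zfT , T<S))

  opaque
    minimumZeroForcing : ∃[ S ] IsMinimumZeroForcing S
    minimumZeroForcing = minimum-acc ⊤ (<-wellFounded _) ⊤-zeroForcing

Z : Graph → ℕ
Z G = ∣ proj₁ (ZeroForcing.minimumZeroForcing G) ∣

module Petersen (n k : ℕ) .{{_ : NonZero n}} where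

  -- u 0, …, u (n-1), v 0, …, v (n-1) enumerate Fin (n + n) without repetition.
  u v : Fin n → Fin (n + n)
  u i = i ↑ˡ n
  v i = n ↑ʳ i

  infixl 6 _⊕_
  _⊕_ : Fin n → ℕ → Fin n
  i ⊕ j = (toℕ i + j) mod n

  data Edge : Rel (Fin (n + n)) 0ℓ where
    outer : ∀ i → Edge (u i) (u (i ⊕ 1))
    spoke : ∀ i → Edge (u i) (v i)
    inner : ∀ i → Edge (v i) (v (i ⊕ k))

  edge? : Decidable Edge
  edge? x y = map′ to from
    (any? (λ i → (u i ≟ x) ×-dec (u (i ⊕ 1) ≟ y)) ⊎-dec
     any? (λ i → (u i ≟ x) ×-dec (v i ≟ y)) ⊎-dec
     any? (λ i → (v i ≟ x) ×-dec (v (i ⊕ k) ≟ y)))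
    where
    Raw : Set
    Raw = (∃[ i ] (u i ≡ x × u (i ⊕ 1) ≡ y)) ⊎
          (∃[ i ] (u i ≡ x × v i ≡ y)) ⊎
          (∃[ i ] (v i ≡ x × v (i ⊕ k) ≡ y))
    to : Raw → Edge x y
    to (inj₁ (i , refl , refl))        = outer i
    to (inj₂ (inj₁ (i , refl , refl))) = spoke i
    to (inj₂ (inj₂ (i , refl , refl))) = inner i
    from : Edge x y → Raw
    from (outer i) = inj₁ (i , refl , refl)
    from (spoke i) = inj₂ (inj₁ (i , refl , refl))
    from (inner i) = inj₂ (inj₂ (i , refl , refl))

  Adj : Rel (Fin (n + n)) 0ℓ
  Adj = SymClosure Edge

  adj? : Decidable Adj
  adj? x y = map′ (λ { (inj₁ e) → fwd e ; (inj₂ e) → bwd e })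
                  (λ { (fwd e) → inj₁ e ; (bwd e) → inj₂ e })
                  (edge? x y ⊎-dec edge? y x)

  shift-≢ : ∀ i {j} → 0 < j → j < n → i ≢ i ⊕ j
  shift-≢ i {j@(ℕ.suc _)} _ j<n i≡i⊕j = >⇒∤ j<n (divides ((toℕ i + j) / n) j≡qn)
    where
    i≡ : toℕ i ≡ (toℕ i + j) % n
    i≡ = trans (cong toℕ i≡i⊕j) (toℕ-fromℕ< _)
    j≡qn : j ≡ (toℕ i + j) / n * n
    j≡qn = +-cancelˡ-≡ (toℕ i) j _
      (trans (m≡m%n+[m/n]*n (toℕ i + j) n)
             (cong (_+ (toℕ i + j) / n * n) (sym i≡)))

  u≢v : ∀ i j → u i ≢ v j
  u≢v i j eq with trans (sym (splitAt-↑ˡ n i n))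
                        (trans (cong (splitAt n) eq) (splitAt-↑ʳ n n j))
  ... | ()

  edge-irrefl : 1 < n → 0 < k → k < n → Irreflexive _≡_ Edge
  edge-irrefl 1<n _ _ eq (outer i) = shift-≢ i (s≤s z≤n) 1<n (↑ˡ-injective n _ _ eq)
  edge-irrefl _ _ _   eq (spoke i) = u≢v i i eq
  edge-irrefl _ 0<k k<n eq (inner i) = shift-≢ i 0<k k<n (↑ʳ-injective n _ _ eq)

  adj-irrefl : 1 < n → 0 < k → k < n → Irreflexive _≡_ Adj
  adj-irrefl a b c eq (fwd e) = edge-irrefl a b c eq e
  adj-irrefl a b c eq (bwd e) = edge-irrefl a b c (sym eq) e

-- The bounds are irrelevant arguments, so P n k does not depend on their proofs.
P : (n k : ℕ) → .(3 ≤ n) → .(1 ≤ k) → .(2 * k < n) → Graph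
P n k 3≤n 1≤k 2k<n = record
  { order  = n + n
  ; Adj    = Adj
  ; adj?   = adj?
  ; symm   = symmetric Edge
  ; irrefl = adj-irrefl
      (≤-trans (s≤s (s≤s z≤n)) (recompute (3 ≤? n) 3≤n))
      (recompute (1 ≤? k) 1≤k)
      (≤-<-trans (m≤m+n k _) (recompute (2 * k <? n) 2k<n))
  }
  where
  open Petersen n k {{>-nonZero (≤-trans (s≤s z≤n) 3≤n)}}

P₃ : (n : ℕ) → .(12 ≤ n) → Graph
P₃ n 12≤n = P n 3
  (≤-trans (s≤s (s≤s (s≤s z≤n))) 12≤n)
  (s≤s z≤n)
  (≤-trans (s≤s (s≤s (s≤s (s≤s (s≤s (s≤s (s≤s z≤n))))))) 12≤n)

{-# OPTIONS --safe #-}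
-- A zero forcing set of size 7 is given by seven consecutive outer vertices. For the lower
-- bound, suppose B ∪ A forces everything although B is not all of V and few vertices of A
-- lie outside B. The first force leaving B ∪ A is made by some u whose closed neighbourhood
-- N[u] lies in B ∪ A except for one vertex. Hence B may be enlarged to B ∪ N[u], which uses
-- up at least |N[u] ─ B| ∸ 1 of the vertices of A outside B. Starting from B = ∅ with six
-- vertices to spend, a search over the choices of u never reaches V.
module Submission where

open import Defs
open import Data.Bool.Base using (Bool; true; false; T; _∧_; _∨_; if_then_else_)
open import Data.Bool.ListAction using (all)
open import Data.Bool.Properties using (T-∧; T-∨; T-≡) renaming (_≟_ to _≟ᵇ_)
open import Data.Empty using (⊥-elim)
open import Data.Fin using (Fin; #_)
open import Data.Fin.Properties using (_≟_)
open import Data.Fin.Subset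
  using (Subset; _∈_; _∉_; _⊆_; _∪_; _∩_; _─_; _-_; ⁅_⁆; ∁; ⊤; ⊥; ∣_∣; inside; outside)
open import Data.Fin.Subset.Properties
  using (_∈?_; ∈⊤; p⊆q⇒∣p∣≤∣q∣; ∣p∩q∣≤∣q∣; ∣p─q∣≤∣p∣; ∣⁅x⁆∣≡1; p⊆p∪q; q⊆p∪q;
         x∈p∪q⁻; x∈p∩q⁺; x∈⁅x⁆; x∈⁅y⁆⇒x≡y; x∈∁p⇒x∉p; p─q─r≡p─q∪r; p─q⊆p;
         x∈p∧x∉q⇒x∈p─q)
open import Data.List.Base as List using (List; []; _∷_; foldl)
open import Data.List.Membership.Propositional.Properties using (∈-tabulate⁺)
import Data.List.Relation.Unary.All as All
open import Data.List.Relation.Unary.All.Properties using (all⁺)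
open import Data.Nat.Base using (ℕ; zero; suc; _+_; _∸_; _≤_; _<_; _<ᵇ_; _≡ᵇ_)
open import Data.Nat.Properties
  using (≤-refl; ≤ᵇ⇒≤; ≤-trans; ≤-reflexive; ≤-antisym; ≮⇒≥; _<?_; <ᵇ⇒<; ≡ᵇ⇒≡; <⇒≱;
         +-suc; +-comm; +-assoc; +-monoˡ-≤; +-monoʳ-≤; m≤n+m; m+n≤o⇒m≤o∸n; module ≤-Reasoning)
open import Data.Product.Base using (_×_; _,_; proj₁; proj₂)
open import Data.Sum.Base using (inj₁; inj₂)
open import Data.Vec.Base using ([]; _∷_; _++_; replicate; tabulate; here; there)
open import Data.Vec.Properties using (lookup⇒[]=; []=⇒lookup; lookup∘tabulate; ≡-dec)
open import Function.Base using (_∘_; case_of_)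
open import Function.Bundles using (Equivalence)
open import Relation.Binary.Construct.Closure.ReflexiveTransitive using (ε; _◅_)
open import Relation.Binary.PropositionalEquality
  using (_≡_; _≢_; refl; sym; trans; cong; subst)
open import Relation.Nullary using (¬_; Dec; yes; no; does; _⊎-dec_; _×-dec_)
open import Relation.Nullary.Decidable using (toWitness; dec-true)

-- Counting in finite subsets.

∣p─q∣+∣p∩q∣≡∣p∣ : ∀ {n} (p q : Subset n) → ∣ p ─ q ∣ + ∣ p ∩ q ∣ ≡ ∣ p ∣
∣p─q∣+∣p∩q∣≡∣p∣ []            []            = refl
∣p─q∣+∣p∩q∣≡∣p∣ (inside ∷ p)  (inside ∷ q)  =
  trans (+-suc _ _) (cong suc (∣p─q∣+∣p∩q∣≡∣p∣ p q))
∣p─q∣+∣p∩q∣≡∣p∣ (inside ∷ p)  (outside ∷ q) = cong suc (∣p─q∣+∣p∩q∣≡∣p∣ p q)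
∣p─q∣+∣p∩q∣≡∣p∣ (outside ∷ p) (inside ∷ q)  = ∣p─q∣+∣p∩q∣≡∣p∣ p q
∣p─q∣+∣p∩q∣≡∣p∣ (outside ∷ p) (outside ∷ q) = ∣p─q∣+∣p∩q∣≡∣p∣ p q

x∈p─q⇒x∉q : ∀ {n} {x : Fin n} (p q : Subset n) → x ∈ p ─ q → x ∉ q
x∈p─q⇒x∉q (_ ∷ p) (_ ∷ q) (there x∈) (there x∈q) =
  x∈p─q⇒x∉q p q x∈ x∈q
x∈p─q⇒x∉q (_ ∷ p) (inside ∷ q) () here

∣p∣≤∣p-x∣+1 : ∀ {n} (p : Subset n) x → ∣ p ∣ ≤ ∣ p - x ∣ + 1
∣p∣≤∣p-x∣+1 p x = begin
  ∣ p ∣                        ≡⟨ ∣p─q∣+∣p∩q∣≡∣p∣ p ⁅ x ⁆ ⟨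
  ∣ p - x ∣ + ∣ p ∩ ⁅ x ⁆ ∣    ≤⟨ +-monoʳ-≤ ∣ p - x ∣ (∣p∩q∣≤∣q∣ p ⁅ x ⁆) ⟩
  ∣ p - x ∣ + ∣ ⁅ x ⁆ ∣        ≡⟨ cong (∣ p - x ∣ +_) (∣⁅x⁆∣≡1 x) ⟩
  ∣ p - x ∣ + 1                ∎
  where open ≤-Reasoning

-- The cost of a branch, with `t` the set `A`, `p` the set `B`, `q` a closed neighbourhood and `x`
-- the forced vertex. Everything in `q ─ p` except possibly `x` lies in `(t ─ p) ∩ q`, which is
-- exactly what `t ─ p` loses.
∣t─p∪q∣+∣q─p∣≤∣t─p∣+1 : ∀ {n} (t p q : Subset n) x → ((q ─ p) - x) ⊆ t →
                        ∣ t ─ (p ∪ q) ∣ + ∣ q ─ p ∣ ≤ ∣ t ─ p ∣ + 1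
∣t─p∪q∣+∣q─p∣≤∣t─p∣+1 t p q x d⊆t = begin
  m + ∣ q ─ p ∣                          ≤⟨ +-monoʳ-≤ m (∣p∣≤∣p-x∣+1 (q ─ p) x) ⟩
  m + (∣ (q ─ p) - x ∣ + 1)              ≡⟨ +-assoc m _ 1 ⟨
  m + ∣ (q ─ p) - x ∣ + 1                ≤⟨ +-monoˡ-≤ 1 (+-monoʳ-≤ m (p⊆q⇒∣p∣≤∣q∣ d⊆)) ⟩
  m + ∣ (t ─ p) ∩ q ∣ + 1                ≡⟨ cong (λ a → ∣ a ∣ + ∣ (t ─ p) ∩ q ∣ + 1) (p─q─r≡p─q∪r t p q) ⟨
  ∣ (t ─ p) ─ q ∣ + ∣ (t ─ p) ∩ q ∣ + 1  ≡⟨ cong (_+ 1) (∣p─q∣+∣p∩q∣≡∣p∣ (t ─ p) q) ⟩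
  ∣ t ─ p ∣ + 1                          ∎
  where
  open ≤-Reasoning
  m = ∣ t ─ (p ∪ q) ∣
  d⊆ : ((q ─ p) - x) ⊆ ((t ─ p) ∩ q)
  d⊆ y∈ = x∈p∩q⁺
    ( x∈p∧x∉q⇒x∈p─q (d⊆t y∈) (x∈p─q⇒x∉q q p y∈q─p)
    , p─q⊆p q p y∈q─p )
    where y∈q─p = p─q⊆p (q ─ p) ⁅ x ⁆ y∈

⊤⊆p∪q⇒∣∁p∣≤∣q─p∣ : ∀ {n} (p q : Subset n) → ⊤ ⊆ (p ∪ q) → ∣ ∁ p ∣ ≤ ∣ q ─ p ∣
⊤⊆p∪q⇒∣∁p∣≤∣q─p∣ p q ⊤⊆ = p⊆q⇒∣p∣≤∣q∣ sub
  where
  sub : ∁ p ⊆ (q ─ p)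
  sub x∈∁p with x∈p∪q⁻ p q (⊤⊆ ∈⊤)
  ... | inj₁ x∈p = ⊥-elim (x∈∁p⇒x∉p x∈∁p x∈p)
  ... | inj₂ x∈q = x∈p∧x∉q⇒x∈p─q x∈q (x∈∁p⇒x∉p x∈∁p)

does≡true⇒holds : ∀ {p} {P : Set p} (P? : Dec P) → does P? ≡ true → P
does≡true⇒holds (yes p) _ = p

x∈p⇒⁅x⁆⊆p : ∀ {n} {x : Fin n} {p} → x ∈ p → ⁅ x ⁆ ⊆ p
x∈p⇒⁅x⁆⊆p {x = x} {p} x∈p y∈ = subst (_∈ p) (sym (x∈⁅y⁆⇒x≡y x y∈)) x∈p

∪-⊆ : ∀ {n} (p q : Subset n) {r} → p ⊆ r → q ⊆ r → (p ∪ q) ⊆ r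
∪-⊆ p q p⊆r q⊆r x∈ with x∈p∪q⁻ p q x∈
... | inj₁ x∈p = p⊆r x∈p
... | inj₂ x∈q = q⊆r x∈q

∪-monoˡ-⊆ : ∀ {n} {p q : Subset n} r → p ⊆ q → (p ∪ r) ⊆ (q ∪ r)
∪-monoˡ-⊆ {p = p} {q} r p⊆q = ∪-⊆ p r (p⊆p∪q r ∘ p⊆q) (q⊆p∪q q r)

─-antimonoʳ-⊆ : ∀ {n} (t : Subset n) {p q} → p ⊆ q → (t ─ q) ⊆ (t ─ p)
─-antimonoʳ-⊆ t {p} {q} p⊆q x∈ =
  x∈p∧x∉q⇒x∈p─q (p─q⊆p t q x∈) (x∈p─q⇒x∉q t q x∈ ∘ p⊆q)

-- Evaluates much faster than the library's ∣ p ─ q ∣.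
∣_─_∣ᶠ : ∀ {n} → Subset n → Subset n → ℕ
∣ []          ─ []          ∣ᶠ = 0
∣ outside ∷ p ─ _ ∷ q       ∣ᶠ = ∣ p ─ q ∣ᶠ
∣ inside ∷ p  ─ inside ∷ q  ∣ᶠ = ∣ p ─ q ∣ᶠ
∣ inside ∷ p  ─ outside ∷ q ∣ᶠ = suc ∣ p ─ q ∣ᶠ

∣p─q∣ᶠ≡∣p─q∣ : ∀ {n} (p q : Subset n) → ∣ p ─ q ∣ᶠ ≡ ∣ p ─ q ∣
∣p─q∣ᶠ≡∣p─q∣ []            []            = refl
∣p─q∣ᶠ≡∣p─q∣ (outside ∷ p) (inside ∷ q)  = ∣p─q∣ᶠ≡∣p─q∣ p q
∣p─q∣ᶠ≡∣p─q∣ (outside ∷ p) (outside ∷ q) = ∣p─q∣ᶠ≡∣p─q∣ p q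
∣p─q∣ᶠ≡∣p─q∣ (inside ∷ p)  (inside ∷ q)  = ∣p─q∣ᶠ≡∣p─q∣ p q
∣p─q∣ᶠ≡∣p─q∣ (inside ∷ p)  (outside ∷ q) = cong suc (∣p─q∣ᶠ≡∣p─q∣ p q)

-- The search for a certificate.

module Search {n : ℕ} (nbhds : List (Subset n)) where

  step : Subset n → Subset n → Subset n
  -- With at most one vertex of `R` missing from `B`, adding `R` spends nothing.
  step B R = if ∣ R ─ B ∣ᶠ <ᵇ 2 then B ∪ R else B

  sweep : Subset n → Subset n
  sweep B = foldl step B nbhds

  mutual
    -- The value true certifies that r vertices outside B do not complete B to a zero forcing
    -- set; f bounds the recursion depth. Any number of sweeps is sound, since enlarging B
    -- only strengthens the conclusion, and three suffice here to close B under forcing.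
    deficient : ℕ → ℕ → Subset n → Bool
    deficient zero    r B = false
    deficient (suc f) r B = branches f r (sweep (sweep (sweep B)))

    branches : ℕ → ℕ → Subset n → Bool
    branches f r B = (r <ᵇ ∣ ∁ B ∣) ∧ all (λ R → branch f r B R ∣ R ─ B ∣ᶠ) nbhds

    branch : ℕ → ℕ → Subset n → Subset n → ℕ → Bool
    -- Here `c` counts `R ─ B`. If it is 0, the centre of `R` has nothing left to force; if it
    -- exceeds `r + 1`, the `c - 1` vertices required from `A` exceed the budget; otherwise
    -- `r - (c - 1)` remain.
    branch f r B R c = (c ≡ᵇ 0) ∨ (suc r <ᵇ c) ∨ deficient f (suc r ∸ c) (B ∪ R)

  step-⊇ : ∀ B R → B ⊆ step B R
  step-⊇ B R with ∣ R ─ B ∣ᶠ <ᵇ 2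
  ... | true  = p⊆p∪q R
  ... | false = λ x∈B → x∈B

  sweep-⊇ : ∀ B → B ⊆ sweep B
  sweep-⊇ B = go B nbhds
    where
    go : ∀ B Rs → B ⊆ foldl step B Rs
    go B []       = λ x∈B → x∈B
    go B (R ∷ Rs) = go (step B R) Rs ∘ step-⊇ B R

-- Soundness of the search.

module LowerBound (G : Graph) where
  open Graph G
  open ZeroForcing G

  closedNbhd : Fin order → Subset order
  closedNbhd u = tabulate λ x → does ((x ≟ u) ⊎-dec adj? u x)

  ∈closedNbhd⁻ : ∀ {u x} → x ∈ closedNbhd u → x ≢ u → Adj u x
  ∈closedNbhd⁻ {u} {x} x∈ x≢u = case does≡true⇒holds ((x ≟ u) ⊎-dec adj? u x)
    (trans (sym (lookup∘tabulate _ x)) ([]=⇒lookup x∈)) of λ where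
      (inj₁ x≡u) → ⊥-elim (x≢u x≡u)
      (inj₂ ux)  → ux

  ∈closedNbhd⁺ : ∀ {u x} → Adj u x → x ∈ closedNbhd u
  ∈closedNbhd⁺ {u} {x} ux = lookup⇒[]= x _
    (trans (lookup∘tabulate _ x) (dec-true ((x ≟ u) ⊎-dec adj? u x) (inj₂ ux)))

  open Search (List.tabulate closedNbhd)

  -- Letting `S` range over all subsets of `B ∪ A` allows induction along the forcing sequence, in
  -- which `S` grows.
  Deficient : ℕ → Subset order → Set
  Deficient r B = ∀ A → ∣ A ─ B ∣ ≤ r → ∀ {S} → S ⊆ (B ∪ A) → ¬ (S ⟶* ⊤)

  Deficient-anti-mono : ∀ {r B C} → B ⊆ C → Deficient r C → Deficient r B
  Deficient-anti-mono {r} {B} {C} B⊆C def A ≤r S⊆ =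
    def A (≤-trans (p⊆q⇒∣p∣≤∣q∣ (─-antimonoʳ-⊆ A B⊆C)) ≤r) (∪-monoˡ-⊆ A B⊆C ∘ S⊆)

  mutual
    deficient-sound : ∀ f r B → T (deficient f r B) → Deficient r B
    deficient-sound (suc f) r B ok = Deficient-anti-mono
      (sweep-⊇ (sweep (sweep B)) ∘ sweep-⊇ (sweep B) ∘ sweep-⊇ B)
      (branches-sound f r (sweep (sweep (sweep B))) ok)

    branches-sound : ∀ f r B → T (branches f r B) → Deficient r B
    branches-sound f r B ok A A≤r = go
      where
      conditions = Equivalence.to T-∧ ok

      go : ∀ {S} → S ⊆ (B ∪ A) → ¬ (S ⟶* ⊤)
      -- `S` is already everything, so `A` would have to contain the whole complement of `B`, which
      -- has more than `r` vertices.
      go S⊆ ε = <⇒≱ (<ᵇ⇒< r _ (proj₁ conditions))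
                    (≤-trans (⊤⊆p∪q⇒∣∁p∣≤∣q─p∣ B A S⊆) A≤r)
      go {S} S⊆ (force {u} {w} (u∈S , (uw , w∉S) , only) ◅ steps) with w ∈? (B ∪ A)
      ... | yes w∈ = go (∪-⊆ S ⁅ w ⁆ S⊆ (x∈p⇒⁅x⁆⊆p w∈)) steps
      -- This is the first force to leave `B ∪ A`, so all of `R` except `w` lies in `S` and hence in
      -- `B ∪ A`.
      ... | no w∉  =
        branch-sound f r B R (All.lookup (all⁺ _ _ (proj₂ conditions)) (∈-tabulate⁺ u))
          A A≤r (x∈p∧x∉q⇒x∈p─q w∈R (w∉ ∘ p⊆p∪q A)) new⊆A
          (∪-⊆ S ⁅ w ⁆ (∪-monoˡ-⊆ A (p⊆p∪q R) ∘ S⊆) (x∈p⇒⁅x⁆⊆p (p⊆p∪q A (q⊆p∪q B R w∈R))))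
          steps
        where
        R = closedNbhd u
        w∈R = ∈closedNbhd⁺ uw

        black : ∀ {x} → x ∈ R → x ≢ w → x ∈ S
        black {x} x∈R x≢w with x ∈? S
        ... | yes x∈S = x∈S
        ... | no x∉S  = ⊥-elim (x≢w (only x (∈closedNbhd⁻ x∈R λ { refl → x∉S u∈S }) x∉S))

        new⊆A : ((R ─ B) - w) ⊆ A
        new⊆A {x} x∈ with x∈p∪q⁻ B A (S⊆ (black (p─q⊆p R B x∈R─B) x≢w))
          where
          x∈R─B = p─q⊆p (R ─ B) ⁅ w ⁆ x∈
          x≢w : x ≢ w
          x≢w refl = x∈p─q⇒x∉q (R ─ B) ⁅ w ⁆ x∈ (x∈⁅x⁆ w)
        ... | inj₁ x∈B = ⊥-elim (x∈p─q⇒x∉q R B (p─q⊆p (R ─ B) ⁅ w ⁆ x∈) x∈B)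
        ... | inj₂ x∈A = x∈A

    branch-sound : ∀ f r B R → T (branch f r B R ∣ R ─ B ∣ᶠ) →
                   ∀ A → ∣ A ─ B ∣ ≤ r → ∀ {w} → w ∈ (R ─ B) → ((R ─ B) - w) ⊆ A →
                   ∀ {S} → S ⊆ ((B ∪ R) ∪ A) → ¬ (S ⟶* ⊤)
    branch-sound f r B R ok A A≤r {w} w∈ new⊆A
      rewrite ∣p─q∣ᶠ≡∣p─q∣ R B
      with Equivalence.to (T-∨ {∣ R ─ B ∣ ≡ᵇ 0}) ok
    ... | inj₁ c≡0 = ⊥-elim (<⇒≱ 0<c (≤-reflexive (≡ᵇ⇒≡ _ 0 c≡0)))
      where
      0<c : 0 < ∣ R ─ B ∣
      0<c = subst (_≤ ∣ R ─ B ∣) (∣⁅x⁆∣≡1 w) (p⊆q⇒∣p∣≤∣q∣ (x∈p⇒⁅x⁆⊆p w∈))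
    ... | inj₂ ok′ with Equivalence.to (T-∨ {suc r <ᵇ ∣ R ─ B ∣}) ok′ | spent
      where
      spent : ∣ A ─ (B ∪ R) ∣ + ∣ R ─ B ∣ ≤ suc r
      -- The sum form avoids truncated subtraction until the recursive call.
      spent = ≤-trans (∣t─p∪q∣+∣q─p∣≤∣t─p∣+1 A B R w new⊆A)
                (≤-trans (+-monoˡ-≤ 1 A≤r) (≤-reflexive (+-comm r 1)))
    ...   | inj₁ r+1<c | spent =
      ⊥-elim (<⇒≱ (<ᵇ⇒< (suc r) _ r+1<c) (≤-trans (m≤n+m ∣ R ─ B ∣ ∣ A ─ (B ∪ R) ∣) spent))
    ...   | inj₂ ok″   | spent =
      deficient-sound f _ (B ∪ R) ok″ A (m+n≤o⇒m≤o∸n ∣ A ─ (B ∪ R) ∣ spent)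

  lowerBound : ∀ f r → deficient f r ⊥ ≡ true → ∀ S → IsZeroForcing S → r < ∣ S ∣
  lowerBound f r ok S zf with r <? ∣ S ∣
  ... | yes r<∣S∣ = r<∣S∣
  -- Take `B` empty and `A = S`.
  ... | no r≮∣S∣  = ⊥-elim (deficient-sound f r ⊥ (Equivalence.from T-≡ ok) S
    (≤-trans (∣p─q∣≤∣p∣ S ⊥) (≮⇒≥ r≮∣S∣)) (q⊆p∪q ⊥ S)
    (subst (S ⟶*_) zf (proj₁ (proj₂ (closure S)))))

-- Explicit forcing sequences.

module UpperBound (G : Graph) where
  open Graph G
  open ZeroForcing G

  ValidForces : Subset order → List (Fin order × Fin order) → Set
  ValidForces B []             = B ≡ ⊤
  ValidForces B ((u , w) ∷ fs) = Forces B u w × ValidForces (B ∪ ⁅ w ⁆) fs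

  validForces? : ∀ B fs → Dec (ValidForces B fs)
  validForces? B []             = ≡-dec _≟ᵇ_ B ⊤
  validForces? B ((u , w) ∷ fs) = forces? B u w ×-dec validForces? (B ∪ ⁅ w ⁆) fs

  validForces⇒⟶*⊤ : ∀ B fs → ValidForces B fs → B ⟶* ⊤
  validForces⇒⟶*⊤ B []             refl     = ε
  validForces⇒⟶*⊤ B ((u , w) ∷ fs) (f , fs-valid) =
    force f ◅ validForces⇒⟶*⊤ (B ∪ ⁅ w ⁆) fs fs-valid

  -- The opaque `cl B` cannot be evaluated. But `⊤` is stalled, so a sequence reaching it makes it a
  -- closure of `B`, and closures are unique.
  validForces⇒zeroForcing : ∀ B fs → ValidForces B fs → IsZeroForcing B
  validForces⇒zeroForcing B fs valid = closure-unique (proj₂ (closure B))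
    (validForces⇒⟶*⊤ B fs valid , λ { u w (_ , (_ , w∉⊤) , _) → w∉⊤ ∈⊤ })

-- The graph P(12,3).

P₁₂,₃ : Graph
P₁₂,₃ = P 12 3 (≤ᵇ⇒≤ 3 12 _) (≤ᵇ⇒≤ 1 3 _) (≤ᵇ⇒≤ 7 12 _)

open ZeroForcing P₁₂,₃ using (IsZeroForcing; minimumZeroForcing)

-- The vertices u 0, …, u 6.
sevenOuter : Subset 24
sevenOuter = replicate 7 inside ++ replicate 17 outside

sevenOuter-forces : List (Fin 24 × Fin 24)
sevenOuter-forces =
  (u (# 1) , v (# 1)) ∷ (u (# 2) , v (# 2)) ∷ (u (# 3) , v (# 3)) ∷
  (u (# 4) , v (# 4)) ∷ (u (# 5) , v (# 5)) ∷
  (v (# 1) , v (# 10)) ∷ (v (# 2) , v (# 11)) ∷ (v (# 4) , v (# 7)) ∷ (v (# 5) , v (# 8)) ∷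
  (v (# 7) , u (# 7)) ∷ (u (# 6) , v (# 6)) ∷ (u (# 7) , u (# 8)) ∷ (u (# 8) , u (# 9)) ∷
  (v (# 3) , v (# 0)) ∷ (u (# 0) , u (# 11)) ∷ (u (# 11) , u (# 10)) ∷ (u (# 9) , v (# 9)) ∷ []
  where open Petersen 12 3

sevenOuter-zeroForcing : IsZeroForcing sevenOuter
sevenOuter-zeroForcing = validForces⇒zeroForcing sevenOuter sevenOuter-forces
  (toWitness {a? = validForces? sevenOuter sevenOuter-forces} _)
  where open UpperBound P₁₂,₃

zeroForcing⇒6<∣S∣ : ∀ S → IsZeroForcing S → 6 < ∣ S ∣
-- Depth 7 covers the budgets 6 down to 0: once the sweeps have closed `B`, every branch that
-- recurses has `c` at least 2 and so spends at least one vertex.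
zeroForcing⇒6<∣S∣ = LowerBound.lowerBound P₁₂,₃ 7 6 refl

Z[P₁₂,₃]≡7 : Z P₁₂,₃ ≡ 7
Z[P₁₂,₃]≡7 = ≤-antisym (minimal sevenOuter sevenOuter-zeroForcing) (zeroForcing⇒6<∣S∣ _ zf)
  where
  zf      = proj₁ (proj₂ minimumZeroForcing)
  minimal = proj₂ (proj₂ minimumZeroForcing)

theorem1 : Z (P 12 3 (≤ᵇ⇒≤ 3 12 _) (≤ᵇ⇒≤ 1 3 _) (≤ᵇ⇒≤ 7 12 _)) ≡ 7
    × Z (P₃ 12 ≤-refl) ≢ 8
    × ¬ ((n : ℕ) (12≤n : 12 ≤ n) → Z (P₃ n 12≤n) ≡ 8)
-- The bounds are irrelevant arguments, so `P₃ 12 ≤-refl` and `P₁₂,₃` are definitionally equal.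
theorem1 = Z[P₁₂,₃]≡7 , Z≢8 , λ Z≡8 → Z≢8 (Z≡8 12 ≤-refl)
  where
  Z≢8 : Z P₁₂,₃ ≢ 8
  Z≢8 Z≡8 = case trans (sym Z[P₁₂,₃]≡7) Z≡8 of λ ()
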